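{- (1) Let $a,b$ be natural numbers such that $ab$ is stable, $\|a\|+\|b\|=\|ab\|+1$, $b>1$, and $a$ is stable. Then there exists $K$ such that for all $k\ge K$, \[\|b(a3^k+1)\|=\|a\|+\|b\|+3k+1.\] (2) If in addition $b$ is also stable, then there exists $K$ such that for all $k\ge K$ and all $\ell\ge0$, \[\|b(a3^k+1)3^\ell\|=\|a\|+\|b\|+3k+3\ell+1.\] Moreover, in both cases such a $K$ can be computed algorithmically from $a$ and $b$.
   Context: For a natural number $n$, $\|n\|$ denotes its integer complexity: the least number of $1$'s needed to write $n$ using only the constant $1$, addition, multiplication, and parentheses. A natural number $n$ is stable if $\|3^kn\|=3k+\|n\|$ for every $k\ge0$. -}

module Defs where

open import Data.Nat using (ℕ; suc; _+_; _*_; _^_; _≤_)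
open import Data.Product using (Σ; _×_)
open import Relation.Binary.PropositionalEquality using (_≡_)

data Expr : Set where
  one  : Expr
  _⊕_  : Expr → Expr → Expr
  _⊗_  : Expr → Expr → Expr

val : Expr → ℕ
val one       = 1
val (e ⊕ f) = val e + val f
val (e ⊗ f) = val e * val f

ones : Expr → ℕ
ones one       = 1
ones (e ⊕ f) = ones e + ones f
ones (e ⊗ f) = ones e + ones f

Cpx : ℕ → ℕ → Set
Cpx n c = Σ Expr (λ e → val e ≡ n × ones e ≡ c) × (∀ (e : Expr) → val e ≡ n → c ≤ ones e)

Stable : ℕ → Set
Stable n = ∀ (k c : ℕ) → Cpx n c → Cpx (3 ^ k * n) (3 * k + c)

{-# OPTIONS --safe #-}
module Submission where

-- Let m = a b and N = b (a 3^k + 1) 3^l = m 3^(k+l) + b 3^l, and suppose N had an expression cheaper than claimed. Its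
-- defect, cost − 3 log₃ value, is then bounded independently of k and l. Factors other than 3 and additions of a smaller
-- summand to a larger one ≥ 3 each consume a fixed amount of defect, so there are boundedly many of them. Hence for k
-- large there is a gap between the sizes of the larger summands. Deleting the smaller summands above the gap yields a
-- bounded number times a power of 3 which is relatively so close to N that it equals m 3^(k+l). As m is stable, the
-- deleted part costs at most 1. It is not empty, since N ≠ m 3^(k+l), so N = γ (u + 1) with γ u = m 3^(k+l). Then
-- γ = b 3^l and u = a 3^k, and the costs of these two factors add up to the claimed value.

open import Defs
open import Data.Nat using (ℕ; zero; suc; _+_; _*_; _^_; _≤_; _<_; z≤n; s≤s; _≤?_; _<?_; NonZero; >-nonZero)
open import Data.Nat.GeneralisedArithmetic using (iterate)
open import Data.Nat.Properties
open import Data.Nat.Tactic.RingSolver using (solve-∀)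
open import Data.Maybe using (Maybe; just; nothing; maybe)
open import Data.Product using (Σ; _×_; _,_; proj₁; proj₂)
open import Data.Sum using (_⊎_; inj₁; inj₂)
open import Relation.Binary.PropositionalEquality using (_≡_; refl; sym; trans; cong; cong₂; subst; subst₂)
open import Relation.Nullary.Decidable using (decidable-stable)
open import Relation.Nullary using (¬_; yes; no; contradiction)

-- Expressions

1≤val : ∀ e → 1 ≤ val e
1≤val one = s≤s z≤n
1≤val (e ⊕ f) = ≤-trans (1≤val e) (m≤m+n _ _)
1≤val (e ⊗ f) = *-mono-≤ (1≤val e) (1≤val f)

1≤ones : ∀ e → 1 ≤ ones e
1≤ones one = s≤s z≤n
1≤ones (e ⊕ f) = ≤-trans (1≤ones e) (m≤m+n _ _)
1≤ones (e ⊗ f) = ≤-trans (1≤ones e) (m≤m+n _ _)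

2≤val⇒2≤ones : ∀ e → 2 ≤ val e → 2 ≤ ones e
2≤val⇒2≤ones one (s≤s ())
2≤val⇒2≤ones (e ⊕ f) _ = +-mono-≤ (1≤ones e) (1≤ones f)
2≤val⇒2≤ones (e ⊗ f) _ = +-mono-≤ (1≤ones e) (1≤ones f)

ones≤1⇒val≡1 : ∀ e → ones e ≤ 1 → val e ≡ 1
ones≤1⇒val≡1 one _ = refl
ones≤1⇒val≡1 (e ⊕ f) p = contradiction (≤-trans (+-mono-≤ (1≤ones e) (1≤ones f)) p) (<⇒≱ ≤-refl)
ones≤1⇒val≡1 (e ⊗ f) p = contradiction (≤-trans (+-mono-≤ (1≤ones e) (1≤ones f)) p) (<⇒≱ ≤-refl)

summand≤1 : ∀ e f → ones e + ones f ≤ 2 → ones e ≤ 1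
summand≤1 e f p = +-cancelʳ-≤ 1 (ones e) 1 (≤-trans (+-monoʳ-≤ (ones e) (1≤ones f)) p)

ones≤2⇒val≤2 : ∀ e → ones e ≤ 2 → val e ≤ 2
ones≤2⇒val≤2 one _ = s≤s z≤n
ones≤2⇒val≤2 (e ⊕ f) p
  rewrite ones≤1⇒val≡1 e (summand≤1 e f p)
        | ones≤1⇒val≡1 f (summand≤1 f e (subst (_≤ 2) (+-comm (ones e) (ones f)) p)) = ≤-refl
ones≤2⇒val≤2 (e ⊗ f) p
  rewrite ones≤1⇒val≡1 e (summand≤1 e f p)
        | ones≤1⇒val≡1 f (summand≤1 f e (subst (_≤ 2) (+-comm (ones e) (ones f)) p)) = s≤s z≤n

suc-sum≤product : ∀ {x y X Y} → suc x ≤ X → suc y ≤ Y → suc (x + y) ≤ X * Y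
suc-sum≤product {x} {y} p q =
  ≤-trans (subst (suc (x + y) ≤_) (identity x y) (m≤m+n _ (x * y))) (*-mono-≤ p q)
  where
  identity : ∀ x y → suc (x + y) + x * y ≡ suc x * suc y
  identity = solve-∀

suc-product≤product : ∀ {x y X Y} → suc x ≤ X → suc y ≤ Y → suc (x * y) ≤ X * Y
suc-product≤product {x} {y} p q =
  ≤-trans (subst (suc (x * y) ≤_) (identity x y) (m≤m+n _ (x + y))) (*-mono-≤ p q)
  where
  identity : ∀ x y → suc (x * y) + (x + y) ≡ suc x * suc y
  identity = solve-∀

-- The strict form makes one induction serve sums and products alike: if `x + 1 ≤ X` and
-- `y + 1 ≤ Y`, then `x + y + 1` and `x * y + 1` are both at most `X * Y`.
val<3^ones : ∀ e → val e < 3 ^ ones e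
val<3^ones one = s≤s (s≤s z≤n)
val<3^ones (e ⊕ f) rewrite ^-distribˡ-+-* 3 (ones e) (ones f) = suc-sum≤product (val<3^ones e) (val<3^ones f)
val<3^ones (e ⊗ f) rewrite ^-distribˡ-+-* 3 (ones e) (ones f) = suc-product≤product (val<3^ones e) (val<3^ones f)

triple : ℕ → Expr → Expr
triple zero e = e
triple (suc k) e = (one ⊕ (one ⊕ one)) ⊗ triple k e

val-triple : ∀ k e → val (triple k e) ≡ 3 ^ k * val e
val-triple zero e = sym (*-identityˡ _)
val-triple (suc k) e rewrite val-triple k e = sym (*-assoc 3 (3 ^ k) (val e))

ones-triple : ∀ k e → ones (triple k e) ≡ 3 * k + ones e
ones-triple zero e = refl
ones-triple (suc k) e rewrite ones-triple k e = identity k (ones e)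
  where
  identity : ∀ k x → 3 + (3 * k + x) ≡ 3 * suc k + x
  identity = solve-∀

-- Descent on the cost: an expression that is not minimal is undercut by a cheaper one of the same
-- value. Under double negation this needs no search through expressions.
¬¬-complexity : ∀ B e → ones e ≤ B → ¬ ¬ Σ ℕ (Cpx (val e))
¬¬-complexity zero e p _ = contradiction (≤-trans (1≤ones e) p) λ ()
¬¬-complexity (suc B) e p none = none (ones e , (e , refl , refl) , minimal)
  where
  minimal : ∀ e′ → val e′ ≡ val e → ones e ≤ ones e′
  minimal e′ eq = ≮⇒≥ λ lt →
    ¬¬-complexity B e′ (≤-pred (≤-trans lt p)) (subst (λ n → ¬ Σ ℕ (Cpx n)) (sym eq) none)

-- Skeletons

-- A normal form: outside the smaller summands, every addition has a larger summand of at least 3,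
-- the range in which adding uses up defect. The smaller summand stays a raw expression because
-- truncation keeps or deletes it whole.
data Skeleton : ℕ → ℕ → Set where
  leaf₁ : Skeleton 1 1
  leaf₂ : Skeleton 2 2
  leaf₃ : Skeleton 3 3
  times : ∀ {x y c d} → Skeleton x c → Skeleton y d → Skeleton (x * y) (c + d)
  plus  : ∀ {u c} → Skeleton u c → 3 ≤ u → (f : Expr) → val f ≤ u → Skeleton (u + val f) (c + ones f)

-- A factor 3 weighs nothing, since three ones for a factor 3 add no defect.
weight : ∀ {x c} → Skeleton x c → ℕ
weight leaf₁ = 1
weight leaf₂ = 1
weight leaf₃ = 0
weight (times s t) = weight s + weight t
weight (plus s _ f _) = weight s + ones f

toExpr : ∀ {x c} → Skeleton x c → Expr
toExpr leaf₁ = one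
toExpr leaf₂ = one ⊕ one
toExpr leaf₃ = one ⊕ (one ⊕ one)
toExpr (times s t) = toExpr s ⊗ toExpr t
toExpr (plus s _ f _) = toExpr s ⊕ f

val-toExpr : ∀ {x c} (s : Skeleton x c) → val (toExpr s) ≡ x
val-toExpr leaf₁ = refl
val-toExpr leaf₂ = refl
val-toExpr leaf₃ = refl
val-toExpr (times s t) = cong₂ _*_ (val-toExpr s) (val-toExpr t)
val-toExpr (plus s _ f _) = cong (_+ val f) (val-toExpr s)

ones-toExpr : ∀ {x c} (s : Skeleton x c) → ones (toExpr s) ≡ c
ones-toExpr leaf₁ = refl
ones-toExpr leaf₂ = refl
ones-toExpr leaf₃ = refl
ones-toExpr (times s t) = cong₂ _+_ (ones-toExpr s) (ones-toExpr t)
ones-toExpr (plus s _ f _) = cong (_+ ones f) (ones-toExpr s)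

SkeletonWithin : ℕ → ℕ → Set
SkeletonWithin x n = Σ ℕ λ c → Skeleton x c × c ≤ n

-- The sums 2, 3 and 4 become two leaves and the product 2 * 2. The last two hypotheses say that a
-- summand 2 costs at least two ones, so the replacement is never dearer.
small-sum : ∀ {u v m n} → 1 ≤ u → 1 ≤ v → u ≤ 2 → v ≤ u
          → 1 ≤ m → 1 ≤ n → (2 ≤ u → 2 ≤ m) → (2 ≤ v → 2 ≤ n) → SkeletonWithin (u + v) (m + n)
small-sum {1} {1} _ _ _ _ p q _ _ = 2 , leaf₂ , +-mono-≤ p q
small-sum {2} {1} _ _ _ _ _ q r _ = 3 , leaf₃ , +-mono-≤ (r ≤-refl) q
small-sum {2} {2} _ _ _ _ _ _ r t = 4 , times leaf₂ leaf₂ , +-mono-≤ (r ≤-refl) (t ≤-refl)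
small-sum {1} {suc (suc _)} _ _ _ (s≤s ())
small-sum {2} {suc (suc (suc _))} _ _ _ (s≤s (s≤s ()))
small-sum {suc (suc (suc _))} _ _ (s≤s (s≤s ()))

ordered-sum : ∀ e f → val f ≤ val e → SkeletonWithin (val e) (ones e) → SkeletonWithin (val e + val f) (ones e + ones f)
ordered-sum e f f≤e (c , s , c≤) with 3 ≤? val e
... | yes 3≤e = c + ones f , plus s 3≤e f f≤e , +-monoˡ-≤ (ones f) c≤
... | no 3≰e = small-sum (1≤val e) (1≤val f) (≤-pred (≰⇒> 3≰e)) f≤e
                 (1≤ones e) (1≤ones f) (2≤val⇒2≤ones e) (2≤val⇒2≤ones f)

skeleton : ∀ e → SkeletonWithin (val e) (ones e)
skeleton one = 1 , leaf₁ , ≤-refl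
skeleton (e ⊗ f) with skeleton e | skeleton f
... | c , s , p | d , t , q = c + d , times s t , +-mono-≤ p q
skeleton (e ⊕ f) with ≤-total (val f) (val e)
... | inj₁ f≤e = ordered-sum e f f≤e (skeleton e)
... | inj₂ e≤f = subst₂ SkeletonWithin (+-comm (val f) (val e)) (+-comm (ones f) (ones e))
                   (ordered-sum f e e≤f (skeleton f))

-- Bounding the weight by the defect

*-interchange : ∀ a b c d → (a * b) * (c * d) ≡ (a * c) * (b * d)
*-interchange = solve-∀

-- Chains `(s / u) ^ 3 ≤ (p / q) ^ 3 ≤ (24 / 9) ^ n`, so that only a comparison of fixed numbers
-- remains.
weight-ratio : ∀ p q n {u s} .{{_ : NonZero (q ^ 3)}} → q * s ≤ p * u → p ^ 3 * 9 ^ n ≤ q ^ 3 * (3 ^ n * 8 ^ n)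
             → s ^ 3 * 9 ^ n ≤ (3 ^ n * 8 ^ n) * u ^ 3
weight-ratio p q n {u} {s} h k = *-cancelˡ-≤ (q ^ 3) (begin
  q ^ 3 * (s ^ 3 * 9 ^ n)           ≡⟨ *-assoc (q ^ 3) (s ^ 3) (9 ^ n) ⟨
  q ^ 3 * s ^ 3 * 9 ^ n             ≡⟨ cong (_* 9 ^ n) (cube-* q s) ⟩
  (q * s) ^ 3 * 9 ^ n               ≤⟨ *-monoˡ-≤ (9 ^ n) (^-monoˡ-≤ 3 h) ⟩
  (p * u) ^ 3 * 9 ^ n               ≡⟨ rearrange p u (9 ^ n) ⟩
  p ^ 3 * 9 ^ n * u ^ 3             ≤⟨ *-monoˡ-≤ (u ^ 3) k ⟩
  q ^ 3 * (3 ^ n * 8 ^ n) * u ^ 3   ≡⟨ *-assoc (q ^ 3) (3 ^ n * 8 ^ n) (u ^ 3) ⟩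
  q ^ 3 * (3 ^ n * 8 ^ n * u ^ 3)   ∎)
  where
  open ≤-Reasoning
  cube-* : ∀ x y → (x * (x * (x * 1))) * (y * (y * (y * 1))) ≡ ((x * y) * ((x * y) * ((x * y) * 1)))
  cube-* = solve-∀
  rearrange : ∀ x y z → ((x * y) * ((x * y) * ((x * y) * 1))) * z ≡ (x * (x * (x * 1))) * z * (y * (y * (y * 1)))
  rearrange = solve-∀

8*9^n≤24^n : ∀ i → 8 * 9 ^ (3 + i) ≤ 3 ^ (3 + i) * 8 ^ (3 + i)
8*9^n≤24^n zero = ≤ᵇ⇒≤ 5832 13824 _
8*9^n≤24^n (suc i) = begin
  8 * (9 * 9 ^ (3 + i))                    ≡⟨ left (9 ^ (3 + i)) ⟩
  9 * (8 * 9 ^ (3 + i))                    ≤⟨ *-mono-≤ (m≤m+n 9 15) (8*9^n≤24^n i) ⟩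
  24 * (3 ^ (3 + i) * 8 ^ (3 + i))         ≡⟨ right (3 ^ (3 + i)) (8 ^ (3 + i)) ⟩
  3 * 3 ^ (3 + i) * (8 * 8 ^ (3 + i))      ∎
  where
  open ≤-Reasoning
  left : ∀ x → 8 * (9 * x) ≡ 9 * (8 * x)
  left = solve-∀
  right : ∀ x y → 24 * (x * y) ≡ 3 * x * (8 * y)
  right = solve-∀

-- The ratio `(u + v) / u` is at most 4/3 for one `1`, 5/3 for two and 2 beyond, and its cube is at
-- most `(8 / 3) ^ n`. The first two ratios come from `3 ≤ u`; with `u = 2` and `v = 1` the bound
-- fails.
weight-plus : ∀ n {u v} → 3 ≤ u → 1 ≤ n → v ≤ u → (n ≤ 1 → v ≡ 1) → (n ≤ 2 → v ≤ 2)
            → (u + v) ^ 3 * 9 ^ n ≤ (3 ^ n * 8 ^ n) * u ^ 3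
weight-plus zero _ ()
weight-plus 1 {u} {v} 3≤u _ _ v≡1 _ = weight-ratio 4 3 1 {u} {u + v} bound (≤ᵇ⇒≤ 576 648 _)
  where
  bound : 3 * (u + v) ≤ 4 * u
  bound rewrite v≡1 ≤-refl = subst₂ _≤_ (left u) (right u) (+-monoʳ-≤ (3 * u) 3≤u)
    where
    left : ∀ u → 3 * u + 3 ≡ 3 * (u + 1)
    left = solve-∀
    right : ∀ u → 3 * u + u ≡ 4 * u
    right = solve-∀
weight-plus 2 {u} {v} 3≤u _ _ _ v≤2 = weight-ratio 5 3 2 {u} {u + v} bound (≤ᵇ⇒≤ 10125 15552 _)
  where
  bound : 3 * (u + v) ≤ 5 * u
  bound = ≤-trans (*-monoʳ-≤ 3 (+-monoʳ-≤ u (v≤2 ≤-refl)))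
    (subst₂ _≤_ (left u) (right u) (+-monoʳ-≤ (3 * u) (*-monoʳ-≤ 2 3≤u)))
    where
    left : ∀ u → 3 * u + 6 ≡ 3 * (u + 2)
    left = solve-∀
    right : ∀ u → 3 * u + 2 * u ≡ 5 * u
    right = solve-∀
weight-plus (suc (suc (suc i))) {u} {v} _ _ v≤u _ _ =
  weight-ratio 2 1 (3 + i) {u} {u + v} bound (≤-trans (8*9^n≤24^n i) (≤-reflexive (sym (*-identityˡ _))))
  where
  bound : 1 * (u + v) ≤ 2 * u
  bound = subst₂ _≤_ (left u v) (right u) (+-monoʳ-≤ u v≤u)
    where
    left : ∀ u v → u + v ≡ 1 * (u + v)
    left = solve-∀
    right : ∀ u → u + u ≡ 2 * u
    right = solve-∀

-- Each unit of weight contributes at least log₃ (9/8) to the defect c − 3 log₃ x.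
weight-bound : ∀ {x c} (s : Skeleton x c) → x ^ 3 * 9 ^ weight s ≤ 3 ^ c * 8 ^ weight s
weight-bound leaf₁ = ≤ᵇ⇒≤ 9 24 _
-- Equality: the defect of 2 is exactly `log₃ (9/8)`, which fixes the unit.
weight-bound leaf₂ = ≤ᵇ⇒≤ 72 72 _
weight-bound leaf₃ = ≤-refl
weight-bound (times {x} {y} {c} {d} s t)
  rewrite ^-distribˡ-+-* 3 c d | ^-distribˡ-+-* 9 (weight s) (weight t) | ^-distribˡ-+-* 8 (weight s) (weight t) =
  subst₂ _≤_ (left x (9 ^ weight s) y (9 ^ weight t)) (*-interchange (3 ^ c) (8 ^ weight s) (3 ^ d) (8 ^ weight t))
    (*-mono-≤ (weight-bound s) (weight-bound t))
  where
  left : ∀ x p y q → ((x * (x * (x * 1))) * p) * ((y * (y * (y * 1))) * q) ≡ ((x * y) * ((x * y) * ((x * y) * 1))) * (p * q)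
  left = solve-∀
weight-bound (plus {u} {c} s 3≤u f f≤u)
  rewrite ^-distribˡ-+-* 3 c (ones f) | ^-distribˡ-+-* 9 (weight s) (ones f) | ^-distribˡ-+-* 8 (weight s) (ones f) = begin
  (u + val f) ^ 3 * (9 ^ weight s * 9 ^ ones f)     ≡⟨ left ((u + val f) ^ 3) (9 ^ weight s) (9 ^ ones f) ⟩
  (u + val f) ^ 3 * 9 ^ ones f * 9 ^ weight s       ≤⟨ *-monoˡ-≤ (9 ^ weight s)
    (weight-plus (ones f) 3≤u (1≤ones f) f≤u (ones≤1⇒val≡1 f) (ones≤2⇒val≤2 f)) ⟩
  3 ^ ones f * 8 ^ ones f * u ^ 3 * 9 ^ weight s    ≡⟨ *-assoc (3 ^ ones f * 8 ^ ones f) (u ^ 3) (9 ^ weight s) ⟩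
  3 ^ ones f * 8 ^ ones f * (u ^ 3 * 9 ^ weight s)  ≤⟨ *-monoʳ-≤ (3 ^ ones f * 8 ^ ones f) (weight-bound s) ⟩
  3 ^ ones f * 8 ^ ones f * (3 ^ c * 8 ^ weight s)  ≡⟨ right (3 ^ ones f) (8 ^ ones f) (3 ^ c) (8 ^ weight s) ⟩
  3 ^ c * 3 ^ ones f * (8 ^ weight s * 8 ^ ones f)  ∎
  where
  open ≤-Reasoning
  left : ∀ x p q → x * (p * q) ≡ x * q * p
  left = solve-∀
  right : ∀ p q x y → p * q * (x * y) ≡ x * p * (y * q)
  right = solve-∀

bernoulli-9/8 : ∀ w → (8 + w) * 8 ^ w ≤ 8 * 9 ^ w
bernoulli-9/8 zero = ≤-refl
bernoulli-9/8 (suc w) = begin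
  (8 + suc w) * (8 * 8 ^ w)                      ≤⟨ m≤m+n _ (w * 8 ^ w) ⟩
  (8 + suc w) * (8 * 8 ^ w) + w * 8 ^ w          ≡⟨ left w (8 ^ w) ⟩
  9 * ((8 + w) * 8 ^ w)                          ≤⟨ *-monoʳ-≤ 9 (bernoulli-9/8 w) ⟩
  9 * (8 * 9 ^ w)                                ≡⟨ right (9 ^ w) ⟩
  8 * (9 * 9 ^ w)                                ∎
  where
  open ≤-Reasoning
  left : ∀ w y → (8 + (1 + w)) * (8 * y) + w * y ≡ 9 * ((8 + w) * y)
  left = solve-∀
  right : ∀ y → 9 * (8 * y) ≡ 8 * (9 * y)
  right = solve-∀

-- The hypotheses make the defect at most `d`, so `(9 / 8) ^ w ≤ 3 ^ d`, and Bernoulli's inequality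
-- bounds `w` uniformly in `h`.
weight≤ : ∀ {x c} (s : Skeleton x c) h d → 3 ^ h ≤ x → c ≤ d + 3 * h → weight s ≤ 8 * 3 ^ d
weight≤ {x} {c} s h d 3^h≤x c≤ = ≤-trans (m≤n+m w 8) (*-cancelʳ-≤ (8 + w) (8 * 3 ^ d) (8 ^ w) (begin
  (8 + w) * 8 ^ w        ≤⟨ bernoulli-9/8 w ⟩
  8 * 9 ^ w              ≤⟨ *-monoʳ-≤ 8 (*-cancelˡ-≤ ((3 ^ h) ^ 3) scaled) ⟩
  8 * (3 ^ d * 8 ^ w)    ≡⟨ *-assoc 8 (3 ^ d) (8 ^ w) ⟨
  8 * 3 ^ d * 8 ^ w      ∎))
  where
  open ≤-Reasoning
  w = weight s
  instance
    8^w≢0 : NonZero (8 ^ w)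
    8^w≢0 = m^n≢0 8 w
    3^h≢0 : NonZero (3 ^ h)
    3^h≢0 = m^n≢0 3 h
    27^h≢0 : NonZero ((3 ^ h) ^ 3)
    27^h≢0 = m^n≢0 (3 ^ h) 3
  scaled : (3 ^ h) ^ 3 * 9 ^ w ≤ (3 ^ h) ^ 3 * (3 ^ d * 8 ^ w)
  scaled = begin
    (3 ^ h) ^ 3 * 9 ^ w             ≤⟨ *-monoˡ-≤ (9 ^ w) (^-monoˡ-≤ 3 3^h≤x) ⟩
    x ^ 3 * 9 ^ w                   ≤⟨ weight-bound s ⟩
    3 ^ c * 8 ^ w                   ≤⟨ *-monoˡ-≤ (8 ^ w) (^-monoʳ-≤ 3 c≤) ⟩
    3 ^ (d + 3 * h) * 8 ^ w         ≡⟨ cong (_* 8 ^ w) (^-distribˡ-+-* 3 d (3 * h)) ⟩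
    3 ^ d * 3 ^ (3 * h) * 8 ^ w     ≡⟨ cong (λ z → 3 ^ d * z * 8 ^ w) (trans (cong (3 ^_) (*-comm 3 h)) (sym (^-*-assoc 3 h 3))) ⟩
    3 ^ d * (3 ^ h) ^ 3 * 8 ^ w     ≡⟨ rearrange (3 ^ d) ((3 ^ h) ^ 3) (8 ^ w) ⟩
    (3 ^ h) ^ 3 * (3 ^ d * 8 ^ w)   ∎
    where
    rearrange : ∀ x y z → x * y * z ≡ y * (x * z)
    rearrange = solve-∀

-- Truncation

-- Cutting goes on only below sums whose larger summand exceeds `T`. A sum kept whole has value at
-- most `2 * T`, which `lead-shape` exploits.
lead : ∀ {x c} → ℕ → Skeleton x c → Expr
lead T leaf₁ = toExpr leaf₁
lead T leaf₂ = toExpr leaf₂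
lead T leaf₃ = toExpr leaf₃
lead T (times s t) = lead T s ⊗ lead T t
lead T (plus {u} s p f q) with T <? u
... | yes _ = lead T s
... | no _ = toExpr (plus s p f q)

drop : ∀ {x c} → ℕ → Skeleton x c → ℕ
drop T leaf₁ = 0
drop T leaf₂ = 0
drop T leaf₃ = 0
drop T (times s t) = drop T s + drop T t
drop T (plus {u} s p f q) with T <? u
... | yes _ = drop T s + ones f
... | no _ = 0

ones-lead : ∀ {x c} T (s : Skeleton x c) → ones (lead T s) + drop T s ≡ c
ones-lead T leaf₁ = refl
ones-lead T leaf₂ = refl
ones-lead T leaf₃ = refl
ones-lead T (times s t) =
  trans (identity (ones (lead T s)) (ones (lead T t)) (drop T s) (drop T t)) (cong₂ _+_ (ones-lead T s) (ones-lead T t))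
  where
  identity : ∀ a b c d → a + b + (c + d) ≡ a + c + (b + d)
  identity = solve-∀
ones-lead T (plus {u} s p f q) with T <? u
... | yes _ = trans (sym (+-assoc (ones (lead T s)) _ _)) (cong (_+ ones f) (ones-lead T s))
... | no _ = trans (+-identityʳ _) (cong (_+ ones f) (ones-toExpr s))

drop≤weight : ∀ {x c} T (s : Skeleton x c) → drop T s ≤ weight s
drop≤weight T leaf₁ = z≤n
drop≤weight T leaf₂ = z≤n
drop≤weight T leaf₃ = z≤n
drop≤weight T (times s t) = +-mono-≤ (drop≤weight T s) (drop≤weight T t)
drop≤weight T (plus {u} s p f q) with T <? u
... | yes _ = +-monoˡ-≤ (ones f) (drop≤weight T s)
... | no _ = z≤n

val-lead≤ : ∀ {x c} T (s : Skeleton x c) → val (lead T s) ≤ x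
val-lead≤ T leaf₁ = ≤-refl
val-lead≤ T leaf₂ = ≤-refl
val-lead≤ T leaf₃ = ≤-refl
val-lead≤ T (times s t) = *-mono-≤ (val-lead≤ T s) (val-lead≤ T t)
val-lead≤ T (plus {u} s p f q) with T <? u
... | yes _ = ≤-trans (val-lead≤ T s) (m≤m+n u (val f))
... | no _ = ≤-reflexive (cong (_+ val f) (val-toExpr s))

drop≡0⇒val-lead : ∀ {x c} T (s : Skeleton x c) → drop T s ≡ 0 → val (lead T s) ≡ x
drop≡0⇒val-lead T leaf₁ _ = refl
drop≡0⇒val-lead T leaf₂ _ = refl
drop≡0⇒val-lead T leaf₃ _ = refl
drop≡0⇒val-lead T (times s t) eq = cong₂ _*_
  (drop≡0⇒val-lead T s (m+n≡0⇒m≡0 (drop T s) eq)) (drop≡0⇒val-lead T t (m+n≡0⇒n≡0 (drop T s) eq))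
drop≡0⇒val-lead T (plus {u} s p f q) eq with T <? u
... | yes _ = contradiction (≤-trans (1≤ones f) (≤-reflexive (m+n≡0⇒n≡0 (drop T s) eq))) λ ()
... | no _ = cong (_+ val f) (val-toExpr s)

drop-anti : ∀ {x c T T′} → T ≤ T′ → (s : Skeleton x c) → drop T′ s ≤ drop T s
drop-anti h leaf₁ = z≤n
drop-anti h leaf₂ = z≤n
drop-anti h leaf₃ = z≤n
drop-anti h (times s t) = +-mono-≤ (drop-anti h s) (drop-anti h t)
drop-anti {T = T} {T′} h (plus {u} s p f q) with T <? u | T′ <? u
... | yes _ | yes _ = +-monoˡ-≤ (ones f) (drop-anti h s)
... | _     | no _ = z≤n
... | no T≮u | yes T′<u = contradiction (≤-trans (s≤s h) T′<u) T≮u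

+-mono-≤-equality : ∀ {a b c d} → a ≤ c → b ≤ d → a + b ≡ c + d → a ≡ c × b ≡ d
+-mono-≤-equality {a} {b} {c} {d} p q eq = a≡c , +-cancelˡ-≡ c b d (trans (cong (_+ b) (sym a≡c)) eq)
  where
  a≡c : a ≡ c
  a≡c = ≤-antisym p (+-cancelʳ-≤ d c a (≤-trans (≤-reflexive (sym eq)) (+-monoʳ-≤ a q)))

-- Raising the threshold lowers the dropped cost at each node or leaves it, so equal totals force
-- equality at every node. As each deleted summand costs something, both thresholds delete the same
-- ones.
drop≡⇒lead≡ : ∀ {x c T T′} → T ≤ T′ → (s : Skeleton x c) → drop T′ s ≡ drop T s → lead T′ s ≡ lead T s
drop≡⇒lead≡ h leaf₁ _ = refl
drop≡⇒lead≡ h leaf₂ _ = refl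
drop≡⇒lead≡ h leaf₃ _ = refl
drop≡⇒lead≡ h (times s t) eq with +-mono-≤-equality (drop-anti h s) (drop-anti h t) eq
... | eq₁ , eq₂ = cong₂ _⊗_ (drop≡⇒lead≡ h s eq₁) (drop≡⇒lead≡ h t eq₂)
drop≡⇒lead≡ {T = T} {T′} h (plus {u} s p f q) eq with T <? u | T′ <? u
... | yes _ | yes _ = drop≡⇒lead≡ h s (+-cancelʳ-≡ (ones f) _ _ eq)
... | no _  | no _ = refl
... | no T≮u | yes T′<u = contradiction (≤-trans (s≤s h) T′<u) T≮u
... | yes _ | no _ = contradiction (≤-trans (1≤ones f) (≤-reflexive (m+n≡0⇒n≡0 (drop T s) (sym eq)))) λ ()

-- `E / T` bounds the relative loss. A deleted `f` stands beside some `u > T`, so it loses a share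
-- of at most `val f / T`, and under products and nested deletions the shares at most add up.
lead-approximates : ∀ {x c} T (s : Skeleton x c) → Σ ℕ λ E → E < 3 ^ drop T s × T * x ≤ T * val (lead T s) + E * x
lead-approximates T leaf₁ = 0 , s≤s z≤n , m≤m+n _ _
lead-approximates T leaf₂ = 0 , s≤s z≤n , m≤m+n _ _
lead-approximates T leaf₃ = 0 , s≤s z≤n , m≤m+n _ _
lead-approximates T (times {x} {y} s t) with lead-approximates T s | lead-approximates T t
... | E , E< , p | F , F< , q rewrite ^-distribˡ-+-* 3 (drop T s) (drop T t) = E + F , suc-sum≤product E< F< , (begin
  T * (x * y)                            ≡⟨ *-assoc T x y ⟨
  T * x * y                              ≤⟨ *-monoˡ-≤ y p ⟩
  (T * x′ + E * x) * y                   ≡⟨ step₁ T x x′ y E ⟩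
  x′ * (T * y) + E * (x * y)             ≤⟨ +-monoˡ-≤ _ (*-monoʳ-≤ x′ q) ⟩
  x′ * (T * y′ + F * y) + E * (x * y)    ≡⟨ step₂ T x x′ y y′ E F ⟩
  x′ * (F * y) + (T * (x′ * y′) + E * (x * y))   ≤⟨ +-monoˡ-≤ _ (*-monoˡ-≤ (F * y) (val-lead≤ T s)) ⟩
  x * (F * y) + (T * (x′ * y′) + E * (x * y))    ≡⟨ step₃ T x x′ y y′ E F ⟩
  T * (x′ * y′) + (E + F) * (x * y)      ∎)
  where
  open ≤-Reasoning
  x′ = val (lead T s)
  y′ = val (lead T t)
  step₁ : ∀ T x x′ y E → (T * x′ + E * x) * y ≡ x′ * (T * y) + E * (x * y)
  step₁ = solve-∀
  step₂ : ∀ T x x′ y y′ E F → x′ * (T * y′ + F * y) + E * (x * y) ≡ x′ * (F * y) + (T * (x′ * y′) + E * (x * y))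
  step₂ = solve-∀
  step₃ : ∀ T x x′ y y′ E F → x * (F * y) + (T * (x′ * y′) + E * (x * y)) ≡ T * (x′ * y′) + (E + F) * (x * y)
  step₃ = solve-∀
lead-approximates T (plus {u} s p f q) with T <? u
... | no _ = 0 , s≤s z≤n , ≤-trans (≤-reflexive (cong (λ z → T * (z + val f)) (sym (val-toExpr s)))) (m≤m+n _ _)
... | yes T<u with lead-approximates T s
... | E , E< , r rewrite ^-distribˡ-+-* 3 (drop T s) (ones f) = E + val f , suc-sum≤product E< (val<3^ones f) , (begin
  T * (u + v)                                    ≡⟨ *-distribˡ-+ T u v ⟩
  T * u + T * v                                  ≤⟨ +-mono-≤ r (*-monoˡ-≤ v (<⇒≤ T<u)) ⟩
  T * u′ + E * u + u * v                         ≤⟨ m≤m+n _ (E * v + v * v) ⟩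
  T * u′ + E * u + u * v + (E * v + v * v)       ≡⟨ identity (T * u′) u v E ⟩
  T * u′ + (E + v) * (u + v)                     ∎)
  where
  open ≤-Reasoning
  v = val f
  u′ = val (lead T s)
  identity : ∀ z u v E → z + E * u + u * v + (E * v + v * v) ≡ z + (E + v) * (u + v)
  identity = solve-∀

-- Leaves 3 go into `3 ^ j`. Every other leaf and every sum kept whole is at most `2 * T` and has
-- weight at least one; deleted summands only enlarge the exponent.
lead-shape : ∀ {x c} T → 1 ≤ T → (s : Skeleton x c)
           → Σ ℕ λ L → Σ ℕ λ j → val (lead T s) ≡ L * 3 ^ j × L ≤ (2 * T) ^ weight s
lead-shape T 1≤T leaf₁ = 1 , 0 , refl , subst (1 ≤_) (sym (*-identityʳ (2 * T))) (≤-trans 1≤T (m≤m+n T _))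
lead-shape T 1≤T leaf₂ = 2 , 0 , refl , subst (2 ≤_) (sym (*-identityʳ (2 * T))) (*-monoʳ-≤ 2 1≤T)
lead-shape T 1≤T leaf₃ = 1 , 1 , refl , ≤-refl
lead-shape T 1≤T (times s t) with lead-shape T 1≤T s | lead-shape T 1≤T t
... | L , j , eq₁ , p | M , k , eq₂ , q rewrite ^-distribˡ-+-* (2 * T) (weight s) (weight t) =
  L * M , j + k , trans (cong₂ _*_ eq₁ eq₂)
    (trans (*-interchange L (3 ^ j) M (3 ^ k)) (cong (L * M *_) (sym (^-distribˡ-+-* 3 j k)))) , *-mono-≤ p q
lead-shape T 1≤T (plus {u} s p f q) with T <? u
... | yes _ with lead-shape T 1≤T s
...   | L , j , eq , r rewrite ^-distribˡ-+-* (2 * T) (weight s) (ones f) =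
  L , j , eq , ≤-trans r (≤-trans (≤-reflexive (sym (*-identityʳ _))) (*-monoʳ-≤ ((2 * T) ^ weight s) (m^n>0 (2 * T) {{2T≢0}} (ones f))))
  where
  2T≢0 : NonZero (2 * T)
  2T≢0 = >-nonZero (*-mono-≤ {1} {2} (s≤s z≤n) 1≤T)
lead-shape T 1≤T (plus {u} s p f q) | no T≮u = u + val f , 0 , trans (cong (_+ val f) (val-toExpr s)) (sym (*-identityʳ _)) , (begin
  u + val f                      ≤⟨ +-mono-≤ u≤T (≤-trans q (≤-trans u≤T (m≤m+n T 0))) ⟩
  2 * T                          ≡⟨ *-identityʳ (2 * T) ⟨
  (2 * T) ^ 1                    ≤⟨ ^-monoʳ-≤ (2 * T) {{2T≢0}} (≤-trans (1≤ones f) (m≤n+m (ones f) (weight s))) ⟩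
  (2 * T) ^ (weight s + ones f)  ∎)
  where
  open ≤-Reasoning
  u≤T = ≮⇒≥ T≮u
  2T≢0 : NonZero (2 * T)
  2T≢0 = >-nonZero (*-mono-≤ {1} {2} (s≤s z≤n) 1≤T)

-- Here nothing stands for the empty product, which costs no ones.
Factor : Set
Factor = Maybe Expr

valᶠ onesᶠ : Factor → ℕ
valᶠ = maybe val 1
onesᶠ = maybe ones 0

_⊗ᶠ_ : Factor → Expr → Factor
nothing ⊗ᶠ e = just e
just g ⊗ᶠ e = just (g ⊗ e)

val-⊗ᶠ : ∀ G e → valᶠ (G ⊗ᶠ e) ≡ valᶠ G * val e
val-⊗ᶠ nothing e = sym (*-identityˡ (val e))
val-⊗ᶠ (just g) e = refl

ones-⊗ᶠ : ∀ G e → onesᶠ (G ⊗ᶠ e) ≡ onesᶠ G + ones e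
ones-⊗ᶠ nothing e = refl
ones-⊗ᶠ (just g) e = refl

-- The values `γ (u + 1)` and `γ u` before and after the deletion of a single `1`, with the cost
-- before.
Splitting : ℕ → ℕ → ℕ → Set
Splitting x y c = Σ Factor λ G → Σ Expr λ U →
  valᶠ G * (val U + 1) ≡ x × valᶠ G * val U ≡ y × onesᶠ G + ones U + 1 ≡ c

splitting-⊗ : ∀ {x y c} → Splitting x y c → ∀ e → Splitting (x * val e) (y * val e) (c + ones e)
splitting-⊗ (G , U , refl , refl , refl) e = G ⊗ᶠ e , U , scale (val U + 1) , scale (val U) ,
  trans (cong (λ z → z + ones U + 1) (ones-⊗ᶠ G e)) (sums (onesᶠ G) (ones e) (ones U))
  where
  products : ∀ g v z → g * v * z ≡ g * z * v
  products = solve-∀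
  sums : ∀ g v z → g + v + z + 1 ≡ g + z + 1 + v
  sums = solve-∀
  scale : ∀ z → valᶠ (G ⊗ᶠ e) * z ≡ valᶠ G * z * val e
  scale z = trans (cong (_* z) (val-⊗ᶠ G e)) (products (valᶠ G) (val e) z)

m+n≡1⇒ : ∀ m {n} → m + n ≡ 1 → (m ≡ 0 × n ≡ 1) ⊎ (m ≡ 1 × n ≡ 0)
m+n≡1⇒ zero eq = inj₁ (refl , eq)
m+n≡1⇒ (suc zero) eq = inj₂ (refl , suc-injective eq)

splitting-× : ∀ {x y c z d} → Splitting x y c → (t : Skeleton z d) → Splitting (x * z) (y * z) (c + d)
splitting-× {x} {y} {c} S t =
  subst₂ (λ z d → Splitting (x * z) (y * z) (c + d)) (val-toExpr t) (ones-toExpr t) (splitting-⊗ S (toExpr t))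

-- Only one summand is deleted, and it is a `1`. A further sum around it would be kept whole or lose
-- a summand as well, so only products lie above it, and their other factors form `G`.
splitting : ∀ {x c} T (s : Skeleton x c) → drop T s ≡ 1 → Splitting x (val (lead T s)) c
splitting T (times {x} {y} {c} {d} s t) eq with m+n≡1⇒ (drop T s) eq
... | inj₂ (s≡1 , t≡0) rewrite drop≡0⇒val-lead T t t≡0 = splitting-× (splitting T s s≡1) t
... | inj₁ (s≡0 , t≡1) rewrite drop≡0⇒val-lead T s s≡0 | *-comm x y | +-comm c d | *-comm x (val (lead T t)) =
  splitting-× (splitting T t t≡1) s
splitting T (plus {u} {c} s p f q) eq with T <? u
... | yes _ with m+n≡1⇒ (drop T s) eq
...   | inj₂ (_ , f≡0) = contradiction (≤-trans (1≤ones f) (≤-reflexive f≡0)) λ ()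
...   | inj₁ (s≡0 , f≡1) rewrite ones≤1⇒val≡1 f (≤-reflexive f≡1) | f≡1 =
  nothing , toExpr s , trans (*-identityˡ _) (cong (_+ 1) (val-toExpr s)) ,
  trans (*-identityˡ _) (trans (val-toExpr s) (sym (drop≡0⇒val-lead T s s≡0))) , cong (_+ 1) (ones-toExpr s)

-- Scales

iterate-inflates : ∀ {g : ℕ → ℕ} → (∀ T → T ≤ g T) → ∀ n T → T ≤ iterate g T n
iterate-inflates h zero T = ≤-refl
iterate-inflates {g} h (suc n) T = ≤-trans (h T) (iterate-inflates h n (g T))

-- `d` starts at `n` or below and falls by at least one whenever it changes, so it stands still
-- within `n + 1` steps. The last bound confines the scale to a range fixed in advance.
stationary : (g d : ℕ → ℕ) → (∀ T → T ≤ g T) → (∀ T → d (g T) ≤ d T) → ∀ n T → d T ≤ n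
           → Σ ℕ λ S → T ≤ S × d (g S) ≡ d S × g S ≤ iterate g T (suc n)
stationary g d infl anti n T dT≤n with d T ≤? d (g T)
... | yes p = T , ≤-refl , ≤-antisym (anti T) p , iterate-inflates infl n (g T)
stationary g d infl anti zero T dT≤n | no p = contradiction (≤-trans dT≤n z≤n) p
stationary g d infl anti (suc n) T dT≤n | no p
  with stationary g d infl anti n (g T) (≤-pred (≤-trans (≰⇒> p) dT≤n))
... | S , gT≤S , eq , bound = S , ≤-trans (infl T) gT≤S , eq , bound

scaled-≤ : ∀ {T A B R} → T * A ≤ T * B + R → R < T → A ≤ B
scaled-≤ {T} {A} {B} {R} h R<T = ≮⇒≥ λ B<A → <⇒≱ R<T (+-cancelˡ-≤ (T * B) T R (begin
  T * B + T    ≡⟨ +-comm (T * B) T ⟩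
  T + T * B    ≡⟨ *-suc T B ⟨
  T * suc B    ≤⟨ *-monoʳ-≤ T B<A ⟩
  T * A        ≤⟨ h ⟩
  T * B + R    ∎))
  where open ≤-Reasoning

scaled-≡ : ∀ {T A B R} → T * A ≤ T * B + R → T * B ≤ T * A + R → R < T → A ≡ B
scaled-≡ p q R<T = ≤-antisym (scaled-≤ p R<T) (scaled-≤ q R<T)

-- Both numbers are multiples of the smaller of 3 ^ j and 3 ^ h, hence equal once they are closer than that.
powers-close⇒≡ : ∀ {T L m Q} j h → 1 ≤ m → 2 * Q * suc L < T
               → T * (L * 3 ^ j) ≤ T * (m * 3 ^ h) + Q * 3 ^ h
               → T * (m * 3 ^ h) ≤ T * (L * 3 ^ j) + Q * 3 ^ h
               → L * 3 ^ j ≡ m * 3 ^ h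
powers-close⇒≡ {T} {L} {m} {Q} j h 1≤m large p q with ≤-total h j
-- After division by `3 ^ h` the error is just `Q`, which is below `T`.
... | inj₁ h≤j with m≤n⇒∃[o]m+o≡n h≤j
...   | i , refl rewrite ^-distribˡ-+-* 3 h i =
  trans (regroup L (3 ^ h) (3 ^ i)) (cong (_* 3 ^ h) (scaled-≡ {T} {L * 3 ^ i} {m}
    (*-cancelʳ-≤ _ _ (3 ^ h) (subst₂ _≤_ (left T L (3 ^ h) (3 ^ i)) (right T m Q (3 ^ h)) p))
    (*-cancelʳ-≤ _ _ (3 ^ h) (subst₂ _≤_ (*-assoc′ T m (3 ^ h)) (right′ T L Q (3 ^ h) (3 ^ i)) q))
    (≤-trans (s≤s Q≤) large)))
  where
  instance
    3^h≢0 : NonZero (3 ^ h)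
    3^h≢0 = m^n≢0 3 h
  regroup : ∀ L x y → L * (x * y) ≡ L * y * x
  regroup = solve-∀
  left : ∀ T L x y → T * (L * (x * y)) ≡ T * (L * y) * x
  left = solve-∀
  right : ∀ T m Q x → T * (m * x) + Q * x ≡ (T * m + Q) * x
  right = solve-∀
  *-assoc′ : ∀ T m x → T * (m * x) ≡ T * m * x
  *-assoc′ = solve-∀
  right′ : ∀ T L Q x y → T * (L * (x * y)) + Q * x ≡ (T * (L * y) + Q) * x
  right′ = solve-∀
  Q≤ : Q ≤ 2 * Q * suc L
  Q≤ = ≤-trans (m≤m+n Q (Q + 0)) (m≤m*n (2 * Q) (suc L))
powers-close⇒≡ {T} {L} {m} {Q} j h 1≤m large p q | inj₂ j≤h with m≤n⇒∃[o]m+o≡n j≤h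
... | i , refl rewrite ^-distribˡ-+-* 3 j i =
  trans (cong (_* 3 ^ j) L≡m3^i) (regroup m (3 ^ j) (3 ^ i))
  where
  open ≤-Reasoning
  instance
    3^j≢0 : NonZero (3 ^ j)
    3^j≢0 = m^n≢0 3 j
    T≢0 : NonZero T
    T≢0 = >-nonZero (≤-trans (s≤s z≤n) large)
  y = 3 ^ i
  regroup : ∀ m x y → m * y * x ≡ m * (x * y)
  regroup = solve-∀
  *-assoc′ : ∀ T m x → T * (m * x) ≡ T * m * x
  *-assoc′ = solve-∀
  left : ∀ T m x y → T * (m * (x * y)) ≡ T * (m * y) * x
  left = solve-∀
  right : ∀ T m Q x y → T * (m * (x * y)) + Q * (x * y) ≡ (T * (m * y) + Q * y) * x
  right = solve-∀
  right′ : ∀ T L Q x y → T * (L * x) + Q * (x * y) ≡ (T * L + Q * y) * x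
  right′ = solve-∀
  above : T * L ≤ T * (m * y) + Q * y
  above = *-cancelʳ-≤ _ _ (3 ^ j) (subst₂ _≤_ (*-assoc′ T L (3 ^ j)) (right T m Q (3 ^ j) y) p)
  below : T * (m * y) ≤ T * L + Q * y
  below = *-cancelʳ-≤ _ _ (3 ^ j) (subst₂ _≤_ (left T m (3 ^ j) y) (right′ T L Q (3 ^ j) y) q)
  2Q≤T : 2 * Q ≤ T
  2Q≤T = ≤-trans (m≤m*n (2 * Q) (suc L)) (<⇒≤ large)
  -- The error `Q * y` left after division by `3 ^ j` contains the unknown power `y`. From `1 ≤ m`,
  -- `below` and `2 * Q ≤ T` follows `y ≤ 2 * L`, hence `Q * y ≤ 2 * Q * L < T`.
  doubled : T * y + T * y ≤ T * (2 * L) + T * y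
  doubled = begin
    T * y + T * y             ≤⟨ +-mono-≤ Ty≤ Ty≤ ⟩
    T * (m * y) + T * (m * y) ≤⟨ +-mono-≤ below below ⟩
    T * L + Q * y + (T * L + Q * y)  ≡⟨ identity T L Q y ⟩
    T * (2 * L) + 2 * Q * y   ≤⟨ +-monoʳ-≤ (T * (2 * L)) (*-monoˡ-≤ y 2Q≤T) ⟩
    T * (2 * L) + T * y       ∎
    where
    Ty≤ : T * y ≤ T * (m * y)
    Ty≤ = *-monoʳ-≤ T (m≤n*m y m {{>-nonZero 1≤m}})
    identity : ∀ T L Q y → T * L + Q * y + (T * L + Q * y) ≡ T * (2 * L) + 2 * Q * y
    identity = solve-∀
  y≤2L : y ≤ 2 * L
  y≤2L = *-cancelˡ-≤ T (+-cancelʳ-≤ (T * y) (T * y) (T * (2 * L)) doubled)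
  Qy<T : Q * y < T
  Qy<T = ≤-trans (s≤s (begin
    Q * y            ≤⟨ *-monoʳ-≤ Q y≤2L ⟩
    Q * (2 * L)      ≡⟨ swap Q L ⟩
    2 * Q * L        ≤⟨ *-monoʳ-≤ (2 * Q) (n≤1+n L) ⟩
    2 * Q * suc L    ∎)) large
    where
    swap : ∀ Q L → Q * (2 * L) ≡ 2 * Q * L
    swap = solve-∀
  L≡m3^i : L ≡ m * 3 ^ i
  L≡m3^i = scaled-≡ {T} above below Qy<T

-- The complexity of b * (a * 3 ^ k + 1) * 3 ^ l

n≤3^n : ∀ n → n ≤ 3 ^ n
n≤3^n zero = z≤n
n≤3^n (suc n) = ≤-trans (+-mono-≤ (m^n>0 3 n) (n≤3^n n)) (+-monoʳ-≤ (3 ^ n) (m≤m+n (3 ^ n) (3 ^ n + 0)))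

target : ℕ → ℕ → ℕ → ℕ → ℕ
target a b k l = b * (a * 3 ^ k + 1) * 3 ^ l

upper-bound : ∀ {a b ca cb} → Cpx a ca → Cpx b cb → ∀ k l
            → Σ Expr λ e → val e ≡ target a b k l × ones e ≡ ca + cb + 3 * k + 3 * l + 1
upper-bound ((e , refl , refl) , _) ((f , refl , refl) , _) k l = t , v , o
  where
  inner t : Expr
  inner = f ⊗ (triple k e ⊕ one)
  t = triple l inner
  v : val t ≡ target (val e) (val f) k l
  v rewrite val-triple l inner | val-triple k e | *-comm (val e) (3 ^ k) = *-comm (3 ^ l) _
  o : ones t ≡ ones e + ones f + 3 * k + 3 * l + 1
  o rewrite ones-triple l inner | ones-triple k e = identity (ones e) (ones f) k l
    where
    identity : ∀ x y k l → 3 * l + (y + (3 * k + x + 1)) ≡ x + y + 3 * k + 3 * l + 1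
    identity = solve-∀

module Scale (m b d : ℕ) where

  maxWeight : ℕ
  maxWeight = 8 * 3 ^ d

  -- Covers two errors, each scaled by `T` and measured in units of `3 ^ (k + l)`: the truncation
  -- loss, which is a factor below `3 ^ maxWeight` times a value of at most `(m + b) * 3 ^ (k + l)`,
  -- and the excess `b * 3 ^ l`.
  spread : ℕ
  spread = (3 ^ maxWeight + b) * (m + b)

  -- Large enough for `powers-close⇒≡` with every coefficient `L` that truncation at `T` can leave.
  next : ℕ → ℕ
  next T = T + suc (2 * spread * suc ((2 * T) ^ maxWeight))

  threshold : ℕ
  threshold = iterate next 1 (suc maxWeight)

module _ {m b d : ℕ} (1≤m : 1 ≤ m) (1≤b : 1 ≤ b) where

  open Scale m b d
  open ≤-Reasoning

  -- Among more scales than the total weight, some window (S, next S] contains no larger summand, so truncating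
  -- at S alters the value too little to miss the multiple m * 3 ^ (k + l) of a large power of 3.
  exact-truncation : ∀ {k l c} → threshold ≤ k → (s : Skeleton (m * 3 ^ (k + l) + b * 3 ^ l) c) → c ≤ d + 3 * (k + l)
                   → Σ ℕ λ S → val (lead S s) ≡ m * 3 ^ (k + l)
  exact-truncation {k} {l} {c} K≤k s c≤
    with stationary next (λ T → drop T s) (λ T → m≤m+n T _) (λ T → drop-anti (m≤m+n T _) s) maxWeight 1 drop≤
    where
    3^h≤N : 3 ^ (k + l) ≤ m * 3 ^ (k + l) + b * 3 ^ l
    3^h≤N = ≤-trans (m≤n*m (3 ^ (k + l)) m {{>-nonZero 1≤m}}) (m≤m+n _ _)
    drop≤ : drop 1 s ≤ maxWeight
    drop≤ = ≤-trans (drop≤weight 1 s) (weight≤ s (k + l) d 3^h≤N c≤)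
  -- Closeness is taken at the upper end of the window and the size of `L` at the lower end; by
  -- `stays` both concern the same truncation.
  ... | S , 1≤S , stays , T≤K with lead-approximates (next S) s | lead-shape S 1≤S s
  ... | E , E< , close | L , j , shape , L≤ = S , trans shape
      (powers-close⇒≡ {T} {L} {m} {spread} j h 1≤m large
        (subst (λ z → T * z ≤ T * M + spread * 3 ^ h) shape from-above)
        (subst (λ z → T * M ≤ T * z + spread * 3 ^ h) shape from-below))
    where
    h T M N : ℕ
    h = k + l
    T = next S
    M = m * 3 ^ h
    N = M + b * 3 ^ l
    w≤ : weight s ≤ maxWeight
    w≤ = weight≤ s h d (≤-trans (m≤n*m (3 ^ h) m {{>-nonZero 1≤m}}) (m≤m+n _ _)) c≤
    2S≢0 : NonZero (2 * S)
    2S≢0 = >-nonZero (*-mono-≤ {1} {2} (s≤s z≤n) 1≤S)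
    large : 2 * spread * suc L < T
    large = ≤-trans (s≤s (*-monoʳ-≤ (2 * spread) (s≤s (≤-trans L≤ (^-monoʳ-≤ (2 * S) {{2S≢0}} w≤))))) (m≤n+m _ S)
    m+b≢0 : NonZero (m + b)
    m+b≢0 = >-nonZero (≤-trans 1≤m (m≤m+n m b))
    b≤spread : b ≤ spread
    b≤spread = ≤-trans (m≤n+m b (3 ^ maxWeight)) (m≤m*n _ (m + b) {{m+b≢0}})
    -- The truncated value may exceed `M` by up to `b * 3 ^ l`. Here the size of `k` enters:
    -- `T ≤ 3 ^ k` turns the scaled excess into at most `b * 3 ^ h`.
    from-above : T * val (lead S s) ≤ T * M + spread * 3 ^ h
    from-above = begin
      T * val (lead S s)           ≤⟨ *-monoʳ-≤ T (val-lead≤ S s) ⟩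
      T * (M + b * 3 ^ l)          ≡⟨ *-distribˡ-+ T M (b * 3 ^ l) ⟩
      T * M + T * (b * 3 ^ l)      ≤⟨ +-monoʳ-≤ (T * M) (*-monoˡ-≤ (b * 3 ^ l) (≤-trans T≤K (≤-trans K≤k (n≤3^n k)))) ⟩
      T * M + 3 ^ k * (b * 3 ^ l)  ≡⟨ cong (T * M +_) (rearrange (3 ^ k) b (3 ^ l)) ⟩
      T * M + b * (3 ^ k * 3 ^ l)  ≡⟨ cong (λ z → T * M + b * z) (^-distribˡ-+-* 3 k l) ⟨
      T * M + b * 3 ^ h            ≤⟨ +-monoʳ-≤ (T * M) (*-monoˡ-≤ (3 ^ h) b≤spread) ⟩
      T * M + spread * 3 ^ h       ∎
      where
      rearrange : ∀ x b y → x * (b * y) ≡ b * (x * y)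
      rearrange = solve-∀
    N≤ : N ≤ (m + b) * 3 ^ h
    N≤ = ≤-trans (+-monoʳ-≤ M (*-monoʳ-≤ b (^-monoʳ-≤ 3 (m≤n+m l k)))) (≤-reflexive (sym (*-distribʳ-+ (3 ^ h) m b)))
    E≤ : E ≤ 3 ^ maxWeight + b
    E≤ = ≤-trans (<⇒≤ E<) (≤-trans (^-monoʳ-≤ 3 (≤-trans (drop≤weight T s) w≤)) (m≤m+n _ b))
    from-below : T * M ≤ T * val (lead S s) + spread * 3 ^ h
    from-below = begin
      T * M                                                  ≤⟨ *-monoʳ-≤ T (m≤m+n M _) ⟩
      T * N                                                  ≤⟨ close ⟩
      T * val (lead T s) + E * N                             ≡⟨ cong (λ z → T * val z + E * N) (drop≡⇒lead≡ (m≤m+n S _) s stays) ⟩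
      T * val (lead S s) + E * N                             ≤⟨ +-monoʳ-≤ _ (*-mono-≤ E≤ N≤) ⟩
      T * val (lead S s) + (3 ^ maxWeight + b) * ((m + b) * 3 ^ h)  ≡⟨ cong (T * val (lead S s) +_) (sym (*-assoc (3 ^ maxWeight + b) (m + b) (3 ^ h))) ⟩
      T * val (lead S s) + spread * 3 ^ h                    ∎

-- Subtracting the two values identifies the factor with `b * 3 ^ l`; cancelling it then gives `U`
-- the value `a * 3 ^ k`.
splitting-cost : ∀ {a b ca cb c} k l → 1 < b → Stable a → Cpx a ca
               → (∀ e → val e ≡ b * 3 ^ l → cb + 3 * l ≤ ones e)
               → Splitting (a * b * 3 ^ (k + l) + b * 3 ^ l) (a * b * 3 ^ (k + l)) c
               → ca + cb + 3 * k + 3 * l + 1 ≤ c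
splitting-cost {a} {b} {ca} {cb} {c} k l 1<b stable-a cpx-a b-cost (G , U , whole , part , refl) = finish G γ≡ refl
  where
  open ≤-Reasoning
  b3^l≢0 : NonZero (b * 3 ^ l)
  b3^l≢0 = >-nonZero (*-mono-≤ (<⇒≤ 1<b) (m^n>0 3 l))
  γ≡ : valᶠ G ≡ b * 3 ^ l
  γ≡ = +-cancelˡ-≡ (a * b * 3 ^ (k + l)) (valᶠ G) (b * 3 ^ l)
    (trans (cong (_+ valᶠ G) (sym part)) (trans (distribute (valᶠ G) (val U)) whole))
    where
    distribute : ∀ g u → g * u + g ≡ g * (u + 1)
    distribute = solve-∀
  U≡ : val U ≡ 3 ^ k * a
  U≡ = *-cancelˡ-≡ (val U) (3 ^ k * a) (b * 3 ^ l) {{b3^l≢0}}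
    (trans (cong (_* val U) (sym γ≡)) (trans part (trans (cong (a * b *_) (^-distribˡ-+-* 3 k l)) (rearrange a b (3 ^ k) (3 ^ l)))))
    where
    rearrange : ∀ a b x y → a * b * (x * y) ≡ b * y * (x * a)
    rearrange = solve-∀
  finish : ∀ F → valᶠ F ≡ b * 3 ^ l → F ≡ G → ca + cb + 3 * k + 3 * l + 1 ≤ onesᶠ G + ones U + 1
  -- The empty product has value 1, which `1 < b` excludes.
  finish nothing eq _ = contradiction (≤-trans 1<b (m≤m*n b (3 ^ l) {{m^n≢0 3 l}})) (subst (λ z → ¬ (2 ≤ z)) eq λ { (s≤s ()) })
  finish (just g) eq refl = begin
    ca + cb + 3 * k + 3 * l + 1         ≡⟨ rearrange ca cb k l ⟩
    cb + 3 * l + (3 * k + ca) + 1       ≤⟨ +-monoˡ-≤ 1 (+-mono-≤ (b-cost g eq) (proj₂ (stable-a k ca cpx-a) U U≡)) ⟩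
    ones g + ones U + 1                 ∎
    where
    rearrange : ∀ x y k l → x + y + 3 * k + 3 * l + 1 ≡ y + 3 * l + (3 * k + x) + 1
    rearrange = solve-∀

truncation-cost : ∀ {a b ca cb cab c} k l → 1 < b → Stable (a * b) → Stable a → Cpx a ca → Cpx (a * b) cab
                → (∀ e → val e ≡ b * 3 ^ l → cb + 3 * l ≤ ones e)
                → (s : Skeleton (a * b * 3 ^ (k + l) + b * 3 ^ l) c) → c ≤ cab + 1 + 3 * (k + l)
                → ∀ S → val (lead S s) ≡ a * b * 3 ^ (k + l)
                → ca + cb + 3 * k + 3 * l + 1 ≤ c
truncation-cost {a} {b} {ca} {cb} {cab} {c} k l 1<b stable-ab stable-a cpx-a cpx-ab b-cost s c≤ S lead≡ =
  by-drop (drop S s) refl drop≤1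
  where
  open ≤-Reasoning
  h M : ℕ
  h = k + l
  M = a * b * 3 ^ h
  -- By stability of `a * b` the kept part already costs `cab + 3 * h`, one less than the bound on
  -- `c`.
  drop≤1 : drop S s ≤ 1
  drop≤1 = +-cancelˡ-≤ (3 * h + cab) (drop S s) 1 (begin
    3 * h + cab + drop S s           ≤⟨ +-monoˡ-≤ (drop S s)
      (proj₂ (stable-ab h cab cpx-ab) (lead S s) (trans lead≡ (*-comm (a * b) (3 ^ h)))) ⟩
    ones (lead S s) + drop S s       ≡⟨ ones-lead S s ⟩
    c                                ≤⟨ c≤ ⟩
    cab + 1 + 3 * h                  ≡⟨ identity cab (3 * h) ⟩
    3 * h + cab + 1                  ∎)
    where
    identity : ∀ x y → x + 1 + y ≡ y + x + 1
    identity = solve-∀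
  by-drop : ∀ n → drop S s ≡ n → n ≤ 1 → ca + cb + 3 * k + 3 * l + 1 ≤ c
  by-drop zero drop≡0 _ = contradiction
    (+-cancelˡ-≡ M 0 (b * 3 ^ l) (trans (+-identityʳ M) (trans (sym lead≡) (drop≡0⇒val-lead S s drop≡0))))
    (<⇒≢ (*-mono-≤ (<⇒≤ 1<b) (m^n>0 3 l)))
  by-drop (suc zero) drop≡1 _ = splitting-cost k l 1<b stable-a cpx-a b-cost
    (subst (λ y → Splitting (M + b * 3 ^ l) y c) lead≡ (splitting S s drop≡1))
  by-drop (suc (suc n)) _ (s≤s ())

-- The hypothesis on the cost of `b * 3 ^ l` lets one argument serve both parts: it is minimality of
-- `cb` at `l = 0`, and stability of `b` for general `l`.
lower-bound : ∀ {a b ca cb} → 1 ≤ a → 1 < b → Stable (a * b) → Stable a → Cpx a ca → Cpx b cb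
            → (∀ cab → Cpx (a * b) cab → ca + cb ≡ cab + 1)
            → ∀ {k} l → Scale.threshold (a * b) b (ca + cb) ≤ k
            → (∀ e → val e ≡ b * 3 ^ l → cb + 3 * l ≤ ones e)
            → ∀ e → val e ≡ target a b k l → ca + cb + 3 * k + 3 * l + 1 ≤ ones e
lower-bound {a} {b} {ca} {cb} 1≤a 1<b stable-ab stable-a cpx-a@((ea , va , _) , _) ((eb , vb , _) , _) sum {k} l K≤k b-cost e eq =
  -- The goal is decidable, so the complexity of `a * b` may be used although it is known only up to
  -- double negation.
  decidable-stable (ca + cb + 3 * k + 3 * l + 1 ≤? ones e) λ p →
    ¬¬-complexity (ones (ea ⊗ eb)) (ea ⊗ eb) ≤-refl λ { (cab , cpx) →
      p (bound p cab (subst (λ n → Cpx n cab) (cong₂ _*_ va vb) cpx)) }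
  where
  h M : ℕ
  h = k + l
  M = a * b * 3 ^ h
  expand : target a b k l ≡ M + b * 3 ^ l
  expand = trans (identity a b (3 ^ k) (3 ^ l)) (cong (λ z → a * b * z + b * 3 ^ l) (sym (^-distribˡ-+-* 3 k l)))
    where
    identity : ∀ a b x y → b * (a * x + 1) * y ≡ a * b * (x * y) + b * y
    identity = solve-∀
  bound : ¬ (ca + cb + 3 * k + 3 * l + 1 ≤ ones e) → ∀ cab → Cpx (a * b) cab → ca + cb + 3 * k + 3 * l + 1 ≤ ones e
  bound p cab cpx-ab = ≤-trans (truncation-cost k l 1<b stable-ab stable-a cpx-a cpx-ab b-cost s
      (subst (λ z → c ≤ z + 3 * h) (sum cab cpx-ab) c≤) (proj₁ truncation) (proj₂ truncation)) (proj₂ (proj₂ found))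
    where
    found : SkeletonWithin (M + b * 3 ^ l) (ones e)
    found = subst (λ x → SkeletonWithin x (ones e)) (trans eq expand) (skeleton e)
    c : ℕ
    c = proj₁ found
    s : Skeleton (M + b * 3 ^ l) c
    s = proj₁ (proj₂ found)
    -- Being cheaper than claimed saves the final 1, so `ca + cb` serves as the defect bound `d`.
    c≤ : c ≤ ca + cb + 3 * h
    c≤ = ≤-trans (proj₂ (proj₂ found)) (≤-pred (subst (suc (ones e) ≤_) (identity ca cb k l) (≰⇒> p)))
      where
      identity : ∀ x y k l → x + y + 3 * k + 3 * l + 1 ≡ 1 + (x + y + 3 * (k + l))
      identity = solve-∀
    truncation : Σ ℕ λ S → val (lead S s) ≡ M
    truncation = exact-truncation {a * b} {b} {ca + cb} (*-mono-≤ 1≤a (<⇒≤ 1<b)) (<⇒≤ 1<b) {k} {l} K≤k s c≤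

theorem1p16 : (a b : ℕ) → 1 ≤ a → 1 < b
    → Stable (a * b)
    → (∀ ca cb cab → Cpx a ca → Cpx b cb → Cpx (a * b) cab → ca + cb ≡ cab + 1)
    → Stable a
    → (∀ ca cb → Cpx a ca → Cpx b cb →
         Σ ℕ (λ K → ∀ k → K ≤ k →
           Cpx (b * (a * 3 ^ k + 1)) (ca + cb + 3 * k + 1)))
      × (Stable b → ∀ ca cb → Cpx a ca → Cpx b cb →
         Σ ℕ (λ K → ∀ k → K ≤ k → ∀ l →
           Cpx (b * (a * 3 ^ k + 1) * 3 ^ l) (ca + cb + 3 * k + 3 * l + 1)))
theorem1p16 a b 1≤a 1<b stable-ab sum stable-a = part₁ , part₂
  where
  complexity : ∀ {ca cb} → Cpx a ca → Cpx b cb → ∀ {k} l → Scale.threshold (a * b) b (ca + cb) ≤ k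
             → (∀ e → val e ≡ b * 3 ^ l → cb + 3 * l ≤ ones e)
             → Cpx (target a b k l) (ca + cb + 3 * k + 3 * l + 1)
  complexity {ca} {cb} cpx-a cpx-b {k} l K≤k b-cost =
    upper-bound cpx-a cpx-b k l ,
    lower-bound 1≤a 1<b stable-ab stable-a cpx-a cpx-b (λ cab → sum ca cb cab cpx-a cpx-b) l K≤k b-cost
  part₁ : ∀ ca cb → Cpx a ca → Cpx b cb → Σ ℕ (λ K → ∀ k → K ≤ k → Cpx (b * (a * 3 ^ k + 1)) (ca + cb + 3 * k + 1))
  part₁ ca cb cpx-a cpx-b = Scale.threshold (a * b) b (ca + cb) , λ k K≤k →
    subst₂ Cpx (*-identityʳ _) (cong (_+ 1) (+-identityʳ (ca + cb + 3 * k)))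
      (complexity cpx-a cpx-b 0 K≤k λ e eq →
        ≤-trans (≤-reflexive (+-identityʳ cb)) (proj₂ cpx-b e (trans eq (*-identityʳ b))))
  part₂ : Stable b → ∀ ca cb → Cpx a ca → Cpx b cb →
    Σ ℕ (λ K → ∀ k → K ≤ k → ∀ l → Cpx (b * (a * 3 ^ k + 1) * 3 ^ l) (ca + cb + 3 * k + 3 * l + 1))
  -- The threshold is an explicit iterate, hence computable, and does not involve `l`, so one `K`
  -- serves every `l`.
  part₂ stable-b ca cb cpx-a cpx-b = Scale.threshold (a * b) b (ca + cb) , λ k K≤k l →
    complexity cpx-a cpx-b l K≤k λ e eq →
      ≤-trans (≤-reflexive (+-comm cb (3 * l))) (proj₂ (stable-b l cb cpx-b) e (trans eq (*-comm b (3 ^ l))))
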